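{- Let $\kappa$ be any cardinal. The functors $N:\mathbf{MKF}_\kappa\to\mathbf{NFR}_\kappa$ and $H:\mathbf{NFR}_\kappa\to\mathbf{MKF}_\kappa$ form an equivalence of categories: for every $\kappa$-downward directed multi-relational Kripke frame $M=\langle W,S\rangle$, the identity map on $W$ is an isomorphism of multi-relational Kripke frames $M\to H(N(M))$, and for every $\kappa$-complete neighborhood frame $Z=\langle C,\nu\rangle$, the identity map on $C$ is an isomorphism of neighborhood frames $Z\to N(H(Z))$ (these identities being natural).
   Context: For a binary relation $R$ on $W$ and $x\in W$, $R[x]=\{y\in W\mid xRy\}$. A multi-relational Kripke frame is a pair $\langle W,S\rangle$ where $W$ is a non-empty set and $S$ is a non-empty set of binary relations on $W$. For a cardinal $\kappa$, it is $\kappa$-downward directed if for every $S'\subseteq S$ with $|S'|<\kappa$ there is $R\in S$ with $R\subseteq\bigcap S'$ (with $\bigcap\emptyset=W\times W$). A homomorphism of multi-relational Kripke frames $f:\langle W_1,S_1\rangle\to\langle W_2,S_2\rangle$ is a map $f:W_1\to W_2$ such that: (i) for every $x\in W_1$ and $R_2\in S_2$ there is $R_1\in S_1$ such that for all $y\in W_1$, $xR_1y$ implies $f(x)R_2f(y)$; (ii) for every $x\in W_1$ and $R_1\in S_1$ there is $R_2\in S_2$ such that for all $u\in W_2$, if $f(x)R_2u$ then there exists $y\in W_1$ with $xR_1y$ and $f(y)=u$. An isomorphism is a bijective homomorphism. $\mathbf{MKF}_\kappa$ is the category of $\kappa$-downward directed multi-relational Kripke frames with these homomorphisms. A neighborhood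 frame is a pair $\langle C,\nu\rangle$ with $C$ non-empty and $\nu:C\to\mathcal P(\mathcal P(C))$. It is $\kappa$-complete if $C\in\nu(c)$ for all $c$, $\nu(c)$ is upward closed under $\subseteq$ for all $c$, and $\bigcap S'\in\nu(c)$ for every $c\in C$ and every non-empty $S'\subseteq\nu(c)$ with $|S'|<\kappa$. A homomorphism of neighborhood frames $f:\langle C_1,\nu_1\rangle\to\langle C_2,\nu_2\rangle$ is a map $f:C_1\to C_2$ such that for all $c\in C_1$, $X\subseteq C_2$: $f^{ -1}[X]\in\nu_1(c)\iff X\in\nu_2(f(c))$. $\mathbf{NFR}_\kappa$ is the category of $\kappa$-complete neighborhood frames with these homomorphisms. $N(\langle W,S\rangle)=\langle W,\nu_M\rangle$ with $\nu_M(x)=\{Y\subseteq W\mid R[x]\subseteq Y\text{ for some }R\in S\}$, and $N(f)=f$. $H(\langle C,\nu\rangle)=\langle C,\{R_v\mid v\in V_Z\}\rangle$ where $V_Z$ is the set of maps $v:C\to\mathcal P(C)$ with $v(x)\in\nu(x)$ for all $x$ and $R_v=\{(x,y)\mid y\in v(x)\}$; $H(f)=f$. -}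

module Defs where

open import Level using (Level; Setω; Lift; lift; lower; _⊔_) renaming (suc to lsuc)
open import Axiom.ExcludedMiddle using (ExcludedMiddle)
open import Data.Empty using (⊥-elim)
open import Data.Product using (Σ-syntax; ∃; ∃-syntax; _×_; _,_; proj₁; proj₂)
open import Data.Unit using (⊤; tt)
open import Function.Base using (id; _∘_)
open import Function.Bundles using (Injection; _⇔_; mk⇔; module Equivalence)
open import Function.Definitions using (Bijective; Congruent; Injective)
open import Induction.WellFounded using (WellFounded; Acc; acc)
open import Relation.Binary.Bundles using (Setoid)
open import Relation.Binary.Core using (Rel; _⇒_) renaming (_⇔_ to _≐ᴿ_)
open import Relation.Binary.Definitions using (_Respects_; tri<; tri≈; tri>)
open import Relation.Binary.Structures using (IsEquivalence; IsStrictTotalOrder)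
open import Relation.Binary.PropositionalEquality
  using (_≡_; refl; sym; trans; cong; subst) renaming (setoid to ≡-setoid)
import Relation.Binary.Construct.On as On
open import Relation.Nullary using (¬_; yes; no)
open import Relation.Unary using (Pred; _∈_; _⊆_; _≐_; _⊢_; Satisfiable)
open import Relation.Unary.Relation.Binary.Equality using (≐-setoid)

private
  variable
    a b c e p q ℓ k o₁ h₁ e₁ o₂ h₂ e₂ o₃ h₃ e₃ : Level

-- The mathematics is classical, so excluded middle is an explicit hypothesis
-- wherever it is needed. Since existentials are Σ-types, no separate axiom of
-- choice is required.
Classical : Setω
Classical = (a : Level) → ExcludedMiddle a

------------------------------------------------------------------------

-- The set of those elements of A that satisfy P, as a setoid: the proofs of
-- P and the choice of representatives modulo ≈ do not count.
⟪_∣_⟫ : (A : Setoid a e) → Pred (Setoid.Carrier A) p → Setoid (a ⊔ p) e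
⟪ A ∣ P ⟫ = On.setoid {B = ∃ P} A proj₁

-- Initial ordinals: well-orders that do not inject into any of their proper
-- initial segments.
record Cardinal (k : Level) : Set (lsuc k) where
  infix 4 _<_
  field
    Carrier            : Set k
    _<_                : Rel Carrier k
    isStrictTotalOrder : IsStrictTotalOrder _≡_ _<_
    <-wellFounded      : WellFounded _<_
    initial            : ∀ x → ¬ Injection (≡-setoid Carrier)
                                           ⟪ ≡-setoid Carrier ∣ _< x ⟫

  setoid : Setoid k k
  setoid = ≡-setoid Carrier

infix 4 ∣_∣<_
∣_∣<_ : Setoid a e → Cardinal k → Set (a ⊔ e ⊔ k)
∣ A ∣< κ = Injection A (Cardinal.setoid κ) × ¬ Injection (Cardinal.setoid κ) A

------------------------------------------------------------------------

-- A subset of X is a predicate, and equality of subsets is mutual inclusion.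
-- Sets of subsets (of relations) are predicates one universe higher, so that
-- intersections of such sets land one universe too high as well. Membership
-- of an intersection in a family of subsets therefore means that the family
-- contains a subset with the same elements (under excluded middle there
-- always is a subset with the same elements).

Relᴿ-setoid : (W : Set ℓ) → Setoid (lsuc ℓ) ℓ
Relᴿ-setoid {ℓ} W = record
  { Carrier       = Rel W ℓ
  ; _≈_           = _≐ᴿ_
  ; isEquivalence = record
    { refl  = id , id
    ; sym   = λ (f , g) → g , f
    ; trans = λ (f , g) (f′ , g′) → (λ z → f′ (f z)) , (λ z → g (g′ z))
    }
  }

⋂ : {X : Set ℓ} → Pred (Pred X ℓ) (lsuc ℓ) → Pred X (lsuc ℓ)
⋂ 𝒮 x = ∀ Y → Y ∈ 𝒮 → x ∈ Y

⋂ᴿ : {W : Set ℓ} → Pred (Rel W ℓ) (lsuc ℓ) → Rel W (lsuc ℓ)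
⋂ᴿ 𝒮 x y = ∀ R → R ∈ 𝒮 → R x y

infix 4 _∈↑_
_∈↑_ : {X : Set ℓ} → Pred X (lsuc ℓ) → Pred (Pred X ℓ) (lsuc ℓ) → Set (lsuc ℓ)
P ∈↑ 𝒮 = ∃[ Y ] (Y ∈ 𝒮 × Y ≐ P)

------------------------------------------------------------------------

record MultiFrame (ℓ : Level) : Set (lsuc (lsuc ℓ)) where
  field
    W          : Set ℓ
    S          : Pred (Rel W ℓ) (lsuc ℓ)
    S-resp     : S Respects _≐ᴿ_
    W-nonempty : W
    S-nonempty : Satisfiable S

IsDirected : Cardinal k → MultiFrame ℓ → Set (k ⊔ lsuc (lsuc ℓ))
IsDirected {ℓ = ℓ} κ M =
  ∀ (S′ : Pred (Rel W ℓ) (lsuc ℓ)) → S′ ⊆ S → ∣ ⟪ Relᴿ-setoid W ∣ S′ ⟫ ∣< κ →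
  ∃[ R ] (R ∈ S × R ⇒ ⋂ᴿ S′)
  where open MultiFrame M

module _ (M₁ M₂ : MultiFrame ℓ) where
  private
    module M₁ = MultiFrame M₁
    module M₂ = MultiFrame M₂

  record IsMultiHom (f : M₁.W → M₂.W) : Set (lsuc ℓ) where
    field
      forth : ∀ x R₂ → R₂ ∈ M₂.S →
              ∃[ R₁ ] (R₁ ∈ M₁.S × (∀ y → R₁ x y → R₂ (f x) (f y)))
      back  : ∀ x R₁ → R₁ ∈ M₁.S →
              ∃[ R₂ ] (R₂ ∈ M₂.S ×
                (∀ u → R₂ (f x) u → ∃[ y ] (R₁ x y × f y ≡ u)))

  IsMultiIso : (M₁.W → M₂.W) → Set (lsuc ℓ)
  IsMultiIso f = IsMultiHom f × Bijective _≡_ _≡_ f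

------------------------------------------------------------------------

record NbhdFrame (ℓ : Level) : Set (lsuc (lsuc ℓ)) where
  field
    C          : Set ℓ
    ν          : C → Pred (Pred C ℓ) (lsuc ℓ)
    ν-resp     : ∀ x → ν x Respects _≐_
    C-nonempty : C

record IsComplete (κ : Cardinal k) (Z : NbhdFrame ℓ) : Set (k ⊔ lsuc (lsuc ℓ)) where
  open NbhdFrame Z
  field
    whole  : ∀ x → (λ _ → Lift ℓ ⊤) ∈ ν x
    upward : ∀ x {X Y : Pred C ℓ} → X ⊆ Y → X ∈ ν x → Y ∈ ν x
    meet   : ∀ x (S′ : Pred (Pred C ℓ) (lsuc ℓ)) → Satisfiable S′ → S′ ⊆ ν x →
             ∣ ⟪ ≐-setoid C ℓ ∣ S′ ⟫ ∣< κ → ⋂ S′ ∈↑ ν x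

module _ (Z₁ Z₂ : NbhdFrame ℓ) where
  private
    module Z₁ = NbhdFrame Z₁
    module Z₂ = NbhdFrame Z₂

  IsNbhdHom : (Z₁.C → Z₂.C) → Set (lsuc ℓ)
  IsNbhdHom f = ∀ x (X : Pred Z₂.C ℓ) → ((f ⊢ X) ∈ Z₁.ν x) ⇔ (X ∈ Z₂.ν (f x))

  IsNbhdIso : (Z₁.C → Z₂.C) → Set (lsuc ℓ)
  IsNbhdIso f = IsNbhdHom f × Bijective _≡_ _≡_ f

------------------------------------------------------------------------

record Category (o h e : Level) : Set (lsuc (o ⊔ h ⊔ e)) where
  infix  4 _≈_
  infixr 9 _⊙_
  field
    Obj     : Set o
    Hom     : Obj → Obj → Set h
    _≈_     : ∀ {A B} → Rel (Hom A B) e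
    1ᵐ      : ∀ {A} → Hom A A
    _⊙_     : ∀ {A B C} → Hom B C → Hom A B → Hom A C
    ≈-equiv : ∀ {A B} → IsEquivalence (_≈_ {A} {B})
    ⊙-cong  : ∀ {A B C} {f f′ : Hom B C} {g g′ : Hom A B} →
              f ≈ f′ → g ≈ g′ → f ⊙ g ≈ f′ ⊙ g′
    idˡ     : ∀ {A B} {f : Hom A B} → 1ᵐ ⊙ f ≈ f
    idʳ     : ∀ {A B} {f : Hom A B} → f ⊙ 1ᵐ ≈ f
    assoc   : ∀ {A B C D} {f : Hom C D} {g : Hom B C} {h : Hom A B} →
              (f ⊙ g) ⊙ h ≈ f ⊙ (g ⊙ h)

record Functor (𝒞 : Category o₁ h₁ e₁) (𝒟 : Category o₂ h₂ e₂)
               : Set (o₁ ⊔ h₁ ⊔ e₁ ⊔ o₂ ⊔ h₂ ⊔ e₂) where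
  private
    module 𝒞 = Category 𝒞
    module 𝒟 = Category 𝒟
  field
    F₀     : 𝒞.Obj → 𝒟.Obj
    F₁     : ∀ {A B} → 𝒞.Hom A B → 𝒟.Hom (F₀ A) (F₀ B)
    F-cong : ∀ {A B} {f g : 𝒞.Hom A B} → f 𝒞.≈ g → F₁ f 𝒟.≈ F₁ g
    F-id   : ∀ {A} → F₁ (𝒞.1ᵐ {A}) 𝒟.≈ 𝒟.1ᵐ
    F-⊙    : ∀ {A B C} {f : 𝒞.Hom B C} {g : 𝒞.Hom A B} →
             F₁ (f 𝒞.⊙ g) 𝒟.≈ F₁ f 𝒟.⊙ F₁ g

Idᶠ : {𝒞 : Category o₁ h₁ e₁} → Functor 𝒞 𝒞
Idᶠ {𝒞 = 𝒞} = record
  { F₀ = id ; F₁ = id ; F-cong = id ; F-id = ≈.refl ; F-⊙ = ≈.refl }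
  where module ≈ {A} {B} = IsEquivalence (Category.≈-equiv 𝒞 {A} {B})

infixr 9 _∘ᶠ_
_∘ᶠ_ : {𝒞 : Category o₁ h₁ e₁} {𝒟 : Category o₂ h₂ e₂} {ℰ : Category o₃ h₃ e₃} →
       Functor 𝒟 ℰ → Functor 𝒞 𝒟 → Functor 𝒞 ℰ
_∘ᶠ_ {ℰ = ℰ} G F = record
  { F₀     = λ A → G.F₀ (F.F₀ A)
  ; F₁     = λ f → G.F₁ (F.F₁ f)
  ; F-cong = λ eq → G.F-cong (F.F-cong eq)
  ; F-id   = ≈.trans (G.F-cong F.F-id) G.F-id
  ; F-⊙    = ≈.trans (G.F-cong F.F-⊙) G.F-⊙
  }
  where
  module F = Functor F
  module G = Functor G
  module ≈ {A} {B} = IsEquivalence (Category.≈-equiv ℰ {A} {B})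

record NaturalIso {𝒞 : Category o₁ h₁ e₁} {𝒟 : Category o₂ h₂ e₂}
                  (F G : Functor 𝒞 𝒟) : Set (o₁ ⊔ h₁ ⊔ h₂ ⊔ e₂) where
  private
    module 𝒞 = Category 𝒞
    module F = Functor F
    module G = Functor G
  open Category 𝒟
  field
    to      : ∀ A → Hom (F.F₀ A) (G.F₀ A)
    from    : ∀ A → Hom (G.F₀ A) (F.F₀ A)
    to-from : ∀ A → to A ⊙ from A ≈ 1ᵐ
    from-to : ∀ A → from A ⊙ to A ≈ 1ᵐ
    natural : ∀ {A B} (f : 𝒞.Hom A B) → G.F₁ f ⊙ to A ≈ to B ⊙ F.F₁ f

record IsEquivalenceOfCategories {𝒞 : Category o₁ h₁ e₁} {𝒟 : Category o₂ h₂ e₂}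
         (F : Functor 𝒞 𝒟) (G : Functor 𝒟 𝒞)
         : Set (o₁ ⊔ h₁ ⊔ e₁ ⊔ o₂ ⊔ h₂ ⊔ e₂) where
  field
    unit   : NaturalIso Idᶠ (G ∘ᶠ F)
    counit : NaturalIso Idᶠ (F ∘ᶠ G)

------------------------------------------------------------------------

record MKFHom (M₁ M₂ : MultiFrame ℓ) : Set (lsuc ℓ) where
  field
    map   : MultiFrame.W M₁ → MultiFrame.W M₂
    isHom : IsMultiHom M₁ M₂ map

record NFRHom (Z₁ Z₂ : NbhdFrame ℓ) : Set (lsuc ℓ) where
  field
    map   : NbhdFrame.C Z₁ → NbhdFrame.C Z₂
    isHom : IsNbhdHom Z₁ Z₂ map

MKF : (ℓ : Level) → Cardinal k → Category (k ⊔ lsuc (lsuc ℓ)) (lsuc ℓ) ℓ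
MKF ℓ κ = record
  { Obj     = Σ[ M ∈ MultiFrame ℓ ] IsDirected κ M
  ; Hom     = λ (M₁ , _) (M₂ , _) → MKFHom M₁ M₂
  ; _≈_     = λ f g → ∀ x → map f x ≡ map g x
  ; 1ᵐ      = record
    { map   = id
    ; isHom = record
      { forth = λ x R R∈ → R , R∈ , λ _ r → r
      ; back  = λ x R R∈ → R , R∈ , λ u r → u , r , refl
      }
    }
  ; _⊙_     = λ g f → record
    { map   = λ x → map g (map f x)
    ; isHom = record
      { forth = λ x R₃ R₃∈ →
          let (R₂ , R₂∈ , q) = forth (isHom g) (map f x) R₃ R₃∈
              (R₁ , R₁∈ , p) = forth (isHom f) x R₂ R₂∈
          in R₁ , R₁∈ , λ y r → q (map f y) (p y r)
      ; back  = λ x R₁ R₁∈ →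
          let (R₂ , R₂∈ , p) = back (isHom f) x R₁ R₁∈
              (R₃ , R₃∈ , q) = back (isHom g) (map f x) R₂ R₂∈
          in R₃ , R₃∈ , λ u r →
               let (v , s , gv≡u) = q u r
                   (y , t , fy≡v) = p v s
               in y , t , trans (cong (map g) fy≡v) gv≡u
      }
    }
  ; ≈-equiv = record
    { refl  = λ _ → refl
    ; sym   = λ eq x → sym (eq x)
    ; trans = λ eq eq′ x → trans (eq x) (eq′ x)
    }
  ; ⊙-cong  = λ {_} {_} {_} {f} {f′} {g} {g′} eq eq′ x →
                trans (cong (map f) (eq′ x)) (eq (map g′ x))
  ; idˡ     = λ _ → refl
  ; idʳ     = λ _ → refl
  ; assoc   = λ _ → refl
  }
  where
  open MKFHom
  open IsMultiHom

NFR : (ℓ : Level) → Cardinal k → Category (k ⊔ lsuc (lsuc ℓ)) (lsuc ℓ) ℓ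
NFR ℓ κ = record
  { Obj     = Σ[ Z ∈ NbhdFrame ℓ ] IsComplete κ Z
  ; Hom     = λ (Z₁ , _) (Z₂ , _) → NFRHom Z₁ Z₂
  ; _≈_     = λ f g → ∀ x → map f x ≡ map g x
  ; 1ᵐ      = record { map = id ; isHom = λ x X → mk⇔ id id }
  ; _⊙_     = λ g f → record
    { map   = λ x → map g (map f x)
    ; isHom = λ x X →
        let F = isHom f x (map g ⊢ X)
            G = isHom g (map f x) X
        in mk⇔ (λ m → Equivalence.to G (Equivalence.to F m))
               (λ m → Equivalence.from F (Equivalence.from G m))
    }
  ; ≈-equiv = record
    { refl  = λ _ → refl
    ; sym   = λ eq x → sym (eq x)
    ; trans = λ eq eq′ x → trans (eq x) (eq′ x)
    }
  ; ⊙-cong  = λ {_} {_} {_} {f} {f′} {g} {g′} eq eq′ x →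
                trans (cong (map f) (eq′ x)) (eq (map g′ x))
  ; idˡ     = λ _ → refl
  ; idʳ     = λ _ → refl
  ; assoc   = λ _ → refl
  }
  where open NFRHom

------------------------------------------------------------------------

module _ (em : Classical) (κ : Cardinal k) where
  private
    module κ = Cardinal κ
    module < = IsStrictTotalOrder κ.isStrictTotalOrder

  least : (Q : Pred κ.Carrier q) → Satisfiable Q →
          ∃[ m ] (m ∈ Q × (∀ j → j κ.< m → ¬ j ∈ Q))
  least {q} Q (i , i∈Q) = go i (κ.<-wellFounded i) i∈Q
    where
    go : ∀ i → Acc κ._<_ i → i ∈ Q → ∃[ m ] (m ∈ Q × (∀ j → j κ.< m → ¬ j ∈ Q))
    go i (acc rs) i∈Q with em (k ⊔ q) {∃[ j ] (j κ.< i × j ∈ Q)}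
    ... | yes (j , j<i , j∈Q) = go j (rs j<i) j∈Q
    ... | no none             = i , i∈Q , λ j j<i j∈Q → none (j , j<i , j∈Q)

  least-cong : (P Q : Pred κ.Carrier q) (s : Satisfiable P) (t : Satisfiable Q) →
               P ≐ Q → proj₁ (least P s) ≡ proj₁ (least Q t)
  least-cong P Q s t (P⊆Q , Q⊆P) with least P s | least Q t
  ... | m , m∈P , m-least | n , n∈Q , n-least with <.compare m n
  ... | tri< m<n _ _ = ⊥-elim (n-least m m<n (P⊆Q m∈P))
  ... | tri≈ _ m≡n _ = m≡n
  ... | tri> _ _ n<m = ⊥-elim (m-least n n<m (Q⊆P n∈Q))

  image-< : (A : Setoid a e) (B : Setoid b c)
            (h : Setoid.Carrier A → Setoid.Carrier B) →
            Congruent (Setoid._≈_ A) (Setoid._≈_ B) h →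
            (∀ y → ∃[ x ] Setoid._≈_ B (h x) y) →
            ∣ A ∣< κ → ∣ B ∣< κ
  image-< {a = a} {c = c} A B h h-cong h-onto (f , f-max) = B↣κ , λ κ↣B → f-max (κ↣A κ↣B)
    where
    module A = Setoid A
    module B = Setoid B
    module f = Injection f

    Q : B.Carrier → Pred κ.Carrier (k ⊔ a ⊔ c)
    Q y i = ∃[ x ] (f.to x ≡ i × h x B.≈ y)

    inhabited : ∀ y → Satisfiable (Q y)
    inhabited y = let (x , hx≈y) = h-onto y in f.to x , x , refl , hx≈y

    m : B.Carrier → κ.Carrier
    m y = proj₁ (least (Q y) (inhabited y))

    m∈Q : ∀ y → m y ∈ Q y
    m∈Q y = proj₁ (proj₂ (least (Q y) (inhabited y)))

    s : B.Carrier → A.Carrier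
    s y = proj₁ (m∈Q y)

    fs≡m : ∀ y → f.to (s y) ≡ m y
    fs≡m y = proj₁ (proj₂ (m∈Q y))

    hs≈ : ∀ y → h (s y) B.≈ y
    hs≈ y = proj₂ (proj₂ (m∈Q y))

    m-cong : Congruent B._≈_ _≡_ m
    m-cong {y} {z} y≈z = least-cong (Q y) (Q z) (inhabited y) (inhabited z)
      ( (λ (x , p , q) → x , p , B.trans q y≈z)
      , (λ (x , p , q) → x , p , B.trans q (B.sym y≈z)) )

    s-injective : Injective B._≈_ A._≈_ s
    s-injective {y} {z} eq = B.trans (B.sym (hs≈ y)) (B.trans (h-cong eq) (hs≈ z))

    m⇒s : ∀ {y z} → m y ≡ m z → s y A.≈ s z
    m⇒s {y} {z} eq = f.injective (trans (fs≡m y) (trans eq (sym (fs≡m z))))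

    B↣κ : Injection B κ.setoid
    B↣κ = record
      { to = m ; cong = m-cong ; injective = λ eq → s-injective (m⇒s eq) }

    κ↣A : Injection κ.setoid B → Injection κ.setoid A
    κ↣A g = record
      { to        = λ i → s (g.to i)
      ; cong      = λ eq → m⇒s (m-cong (g.cong eq))
      ; injective = λ eq → g.injective (s-injective eq)
      }
      where module g = Injection g

  -- A choice of representatives of the ≈-classes of a small setoid.
  module _ (A : Setoid a e) (f : Injection A κ.setoid) where
    private
      module A = Setoid A
      module f = Injection f

    pick : ∀ i → ∃[ x ] f.to x ≡ i → ∃[ x ] f.to x ≡ i
    pick i w with em (a ⊔ k) {∃[ x ] f.to x ≡ i}
    ... | yes v = v
    ... | no ¬w = ⊥-elim (¬w w)

    pick-irr : ∀ i w w′ → pick i w ≡ pick i w′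
    pick-irr i w w′ with em (a ⊔ k) {∃[ x ] f.to x ≡ i}
    ... | yes v = refl
    ... | no ¬w = ⊥-elim (¬w w)

    rep : A.Carrier → A.Carrier
    rep x = proj₁ (pick (f.to x) (x , refl))

    rep-≈ : ∀ x → rep x A.≈ x
    rep-≈ x = f.injective (proj₂ (pick (f.to x) (x , refl)))

    rep-cong : ∀ {x y} → x A.≈ y → rep x ≡ rep y
    rep-cong {x} {y} x≈y = lemma (f.cong x≈y) (x , refl) (y , refl)
      where
      lemma : ∀ {i j} → i ≡ j → ∀ w w′ → proj₁ (pick i w) ≡ proj₁ (pick j w′)
      lemma {i} refl w w′ = cong proj₁ (pick-irr i w w′)

resize : Classical → {X : Set ℓ} (P : Pred X p) → ∃[ Y ] (_≐_ {ℓ₁ = ℓ} Y P)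
resize {ℓ} {p} em {X} P = Y , Y⊆P , P⊆Y
  where
  Y : Pred X ℓ
  Y x with em p {P x}
  ... | yes _ = Lift ℓ ⊤
  ... | no  _ = Lift ℓ (¬ ⊤)

  Y⊆P : Y ⊆ P
  Y⊆P {x} y with em p {P x}
  ... | yes p = p
  ... | no  _ = ⊥-elim (lower y tt)

  P⊆Y : P ⊆ Y
  P⊆Y {x} p′ with em p {P x}
  ... | yes _ = lift tt
  ... | no ¬p = ⊥-elim (¬p p′)

------------------------------------------------------------------------

N-frame : MultiFrame ℓ → NbhdFrame ℓ
N-frame M = record
  { C          = W
  ; ν          = λ x Y → ∃[ R ] (R ∈ S × R x ⊆ Y)
  ; ν-resp     = λ x (Y⊆Z , _) (R , R∈ , R⊆Y) → R , R∈ , λ r → Y⊆Z (R⊆Y r)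
  ; C-nonempty = W-nonempty
  }
  where open MultiFrame M

N-complete : Classical → (κ : Cardinal k) (M : MultiFrame ℓ) →
             IsDirected κ M → IsComplete κ (N-frame M)
N-complete {ℓ = ℓ} em κ M directed = record
  { whole  = λ x → let (R , R∈) = S-nonempty in R , R∈ , λ _ → lift tt
  ; upward = λ x X⊆Y (R , R∈ , R⊆X) → R , R∈ , λ r → X⊆Y (R⊆X r)
  ; meet   = meet′
  }
  where
  open MultiFrame M

  meet′ : ∀ x (S′ : Pred (Pred W ℓ) (lsuc ℓ)) → Satisfiable S′ →
          S′ ⊆ NbhdFrame.ν (N-frame M) x → ∣ ⟪ ≐-setoid W ℓ ∣ S′ ⟫ ∣< κ →
          ⋂ S′ ∈↑ NbhdFrame.ν (N-frame M) x
  meet′ x S′ _ S′⊆ν small@(f , _) = Y , (R , R∈ , λ r → proj₂ Y≐ (R⊆⋂ r)) , Y≐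
    where
    A : Setoid (lsuc ℓ) ℓ
    A = ⟪ ≐-setoid W ℓ ∣ S′ ⟫

    r : Setoid.Carrier A → Setoid.Carrier A
    r = rep em κ A f

    h : Setoid.Carrier A → Rel W ℓ
    h X = proj₁ (S′⊆ν (proj₂ (r X)))

    h∈S : ∀ X → h X ∈ S
    h∈S X = proj₁ (proj₂ (S′⊆ν (proj₂ (r X))))

    h⊆ : ∀ X → h X x ⊆ proj₁ X
    h⊆ X s = proj₁ (rep-≈ em κ A f X) (proj₂ (proj₂ (S′⊆ν (proj₂ (r X)))) s)

    S″ : Pred (Rel W ℓ) (lsuc ℓ)
    S″ R = ∃[ X ] h X ≐ᴿ R

    h-cong : ∀ {X X′} → Setoid._≈_ A X X′ → h X ≐ᴿ h X′
    h-cong {X} {X′} eq =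
      subst (λ (Z : Setoid.Carrier A) → h X ≐ᴿ proj₁ (S′⊆ν (proj₂ Z)))
            (rep-cong em κ A f {X} {X′} eq) (id , id)

    small″ : ∣ ⟪ Relᴿ-setoid W ∣ S″ ⟫ ∣< κ
    small″ = image-< em κ A ⟪ Relᴿ-setoid W ∣ S″ ⟫
      (λ X → h X , X , id , id) (λ {X} {X′} → h-cong {X} {X′}) (λ (_ , X , eq) → X , eq) small

    bound : ∃[ R ] (R ∈ S × R ⇒ ⋂ᴿ S″)
    bound = directed S″ (λ (X , eq) → S-resp eq (h∈S X)) small″

    R = proj₁ bound
    R∈ = proj₁ (proj₂ bound)

    R⊆⋂ : R x ⊆ ⋂ S′
    R⊆⋂ s X X∈ = h⊆ (X , X∈) (proj₂ (proj₂ bound) s (h (X , X∈)) ((X , X∈) , id , id))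

    Y = proj₁ (resize em (⋂ S′))
    Y≐ = proj₂ (resize em (⋂ S′))

N-hom : (M₁ M₂ : MultiFrame ℓ) (f : MultiFrame.W M₁ → MultiFrame.W M₂) →
        IsMultiHom M₁ M₂ f → IsNbhdHom (N-frame M₁) (N-frame M₂) f
N-hom M₁ M₂ f hom x X = mk⇔
  (λ (R₁ , R₁∈ , R₁⊆) →
    let (R₂ , R₂∈ , p) = back x R₁ R₁∈
    in R₂ , R₂∈ , λ {u} s → let (y , t , fy≡u) = p u s in subst X fy≡u (R₁⊆ t))
  (λ (R₂ , R₂∈ , R₂⊆) →
    let (R₁ , R₁∈ , p) = forth x R₂ R₂∈
    in R₁ , R₁∈ , λ {y} s → R₂⊆ (p y s))
  where open IsMultiHom hom

N : Classical → (κ : Cardinal k) → Functor (MKF ℓ κ) (NFR ℓ κ)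
N em κ = record
  { F₀     = λ (M , directed) → N-frame M , N-complete em κ M directed
  ; F₁     = λ {(M₁ , _)} {(M₂ , _)} f → record
    { map = MKFHom.map f ; isHom = N-hom M₁ M₂ (MKFHom.map f) (MKFHom.isHom f) }
  ; F-cong = id
  ; F-id   = λ _ → refl
  ; F-⊙    = λ _ → refl
  }

------------------------------------------------------------------------

V : (Z : NbhdFrame ℓ) → Pred (NbhdFrame.C Z → Pred (NbhdFrame.C Z) ℓ) (lsuc ℓ)
V Z v = ∀ x → v x ∈ NbhdFrame.ν Z x

R⟨_⟩ : {C : Set ℓ} → (C → Pred C ℓ) → Rel C ℓ
R⟨ v ⟩ x y = y ∈ v x

H-frame : (κ : Cardinal k) (Z : NbhdFrame ℓ) → IsComplete κ Z → MultiFrame ℓ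
H-frame κ Z complete = record
  { W          = C
  ; S          = λ R → ∃[ v ] (v ∈ V Z × R ≐ᴿ R⟨ v ⟩)
  ; S-resp     = λ (R⊆Q , Q⊆R) (v , v∈ , R⊆v , v⊆R) →
                   v , v∈ , (λ q → R⊆v (Q⊆R q)) , (λ r → R⊆Q (v⊆R r))
  ; W-nonempty = C-nonempty
  ; S-nonempty = _ , _ , IsComplete.whole complete , id , id
  }
  where open NbhdFrame Z

H-directed : Classical → (κ : Cardinal k) (Z : NbhdFrame ℓ) (complete : IsComplete κ Z) →
             IsDirected κ (H-frame κ Z complete)
H-directed {ℓ = ℓ} em κ Z complete S′ S′⊆S small with em (lsuc ℓ) {Satisfiable S′}
... | no none = _ , (_ , whole , id , id) , λ _ R R∈ → ⊥-elim (none (R , R∈))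
  where open IsComplete complete
... | yes (Q , Q∈) = R⟨ v ⟩ , (v , v∈ , id , id) ,
        λ {x} {y} s R R∈ → proj₂ (proj₂ (bound x)) s (R x) (R , R∈ , id , id)
  where
  open NbhdFrame Z
  open IsComplete complete

  At : C → Pred (Pred C ℓ) (lsuc ℓ)
  At x X = ∃[ R ] (R ∈ S′ × R x ≐ X)

  At⊆ν : ∀ x → At x ⊆ ν x
  At⊆ν x (R , R∈ , Rx⊆X , X⊆Rx) =
    let (v , v∈ , R⊆v , v⊆R) = S′⊆S R∈
    in ν-resp x ((λ s → Rx⊆X (v⊆R s)) , (λ s → R⊆v (X⊆Rx s))) (v∈ x)

  bound′ : ∀ x → ⋂ (At x) ∈↑ ν x
  bound′ x = meet x (At x) (Q x , Q , Q∈ , id , id) (At⊆ν x)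
    (image-< em κ ⟪ Relᴿ-setoid C ∣ S′ ⟫ ⟪ ≐-setoid C ℓ ∣ At x ⟫
      (λ (R , R∈) → R x , R , R∈ , id , id)
      (λ (p , q) → (λ s → p s) , (λ s → q s))
      (λ (X , R , R∈ , eq) → (R , R∈) , eq)
      small)

  bound : ∀ x → ∃[ Y ] (Y ∈ ν x × Y ⊆ ⋂ (At x))
  bound x = let (Y , Y∈ , Y⊆ , _) = bound′ x in Y , Y∈ , Y⊆

  v : C → Pred C ℓ
  v x = proj₁ (bound x)

  v∈ : v ∈ V Z
  v∈ x = proj₁ (proj₂ (bound x))

H-hom : Classical → (κ : Cardinal k) (Z₁ Z₂ : NbhdFrame ℓ)
        (c₁ : IsComplete κ Z₁) (c₂ : IsComplete κ Z₂)
        (f : NbhdFrame.C Z₁ → NbhdFrame.C Z₂) → IsNbhdHom Z₁ Z₂ f →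
        IsMultiHom (H-frame κ Z₁ c₁) (H-frame κ Z₂ c₂) f
H-hom {ℓ = ℓ} em κ Z₁ Z₂ c₁ c₂ f hom = record
  { forth = λ x R₂ (v , v∈ , R₂⊆v , v⊆R₂) →
      (λ z y → R₂ (f z) (f y)) ,
      ( (λ z → f ⊢ v (f z))
      , (λ z → Equivalence.from (hom z (v (f z))) (v∈ (f z)))
      , R₂⊆v , v⊆R₂ ) ,
      λ y r → r
  ; back  = back′
  }
  where
  module Z₁ = NbhdFrame Z₁
  module Z₂ = NbhdFrame Z₂
  module c₁ = IsComplete c₁
  module c₂ = IsComplete c₂

  back′ : ∀ x R₁ → R₁ ∈ MultiFrame.S (H-frame κ Z₁ c₁) →
          ∃[ R₂ ] (R₂ ∈ MultiFrame.S (H-frame κ Z₂ c₂) ×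
            (∀ u → R₂ (f x) u → ∃[ y ] (R₁ x y × f y ≡ u)))
  back′ x R₁ (v , v∈ , _ , v⊆R₁) = R⟨ w ⟩ , (w , w∈ , id , id) , λ u s → s refl
    where
    X : Pred Z₂.C ℓ
    X u = ∃[ y ] (R₁ x y × f y ≡ u)

    X∈ : X ∈ Z₂.ν (f x)
    X∈ = Equivalence.to (hom x X) (c₁.upward x (λ s → _ , v⊆R₁ s , refl) (v∈ x))

    w : Z₂.C → Pred Z₂.C ℓ
    w z u = z ≡ f x → u ∈ X

    w∈ : w ∈ V Z₂
    w∈ z with em ℓ {z ≡ f x}
    ... | yes refl = c₂.upward (f x) (λ s _ → s) X∈
    ... | no z≢fx  = c₂.upward z (λ _ eq → ⊥-elim (z≢fx eq)) (c₂.whole z)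

H : Classical → (κ : Cardinal k) → Functor (NFR ℓ κ) (MKF ℓ κ)
H em κ = record
  { F₀     = λ (Z , complete) → H-frame κ Z complete , H-directed em κ Z complete
  ; F₁     = λ {(Z₁ , c₁)} {(Z₂ , c₂)} f → record
    { map = NFRHom.map f ; isHom = H-hom em κ Z₁ Z₂ c₁ c₂ (NFRHom.map f) (NFRHom.isHom f) }
  ; F-cong = id
  ; F-id   = λ _ → refl
  ; F-⊙    = λ _ → refl
  }

{-# OPTIONS --safe #-}

-- Only the neighborhoods R[x] at one point at a time matter on either side:
-- every R ∈ S is R_v for v = (x ↦ R[x]), and a member X of ν(x) extends to a
-- v ∈ V_Z that takes the whole of C as its value away from x.
module Submission where

open import Defs
open import Level using (Level)
open import Axiom.ExcludedMiddle using (ExcludedMiddle)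
open import Data.Empty using (⊥-elim)
open import Data.Product using (Σ-syntax; ∃-syntax; _×_; _,_; proj₁)
open import Function.Base using (id)
open import Function.Bundles using (mk⇔)
open import Function.Construct.Identity using (bijective)
open import Function.Properties.Equivalence using () renaming (sym to ⇔-sym)
open import Relation.Binary.PropositionalEquality using (_≡_; refl)
open import Relation.Nullary using (yes; no)
open import Relation.Unary using (Pred; _∈_; _⊆_)

private
  variable
    k ℓ : Level

module _ (κ : Cardinal k) (M : MultiFrame ℓ) (complete : IsComplete κ (N-frame M)) where
  open MultiFrame M

  -- `forth` fixes `x` before a relation is chosen, so the `Q` in `S` that witnesses `v x` as a
  -- neighborhood may vary with `x`; no single `Q` has to lie inside `R⟨ v ⟩` everywhere.
  id-to-HN : IsMultiHom M (H-frame κ (N-frame M) complete) id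
  id-to-HN = record
    { forth = λ x R (v , v∈ , _ , v⊆R) →
        let (Q , Q∈ , Q⊆v) = v∈ x
        in Q , Q∈ , λ y q → v⊆R (Q⊆v q)
    ; back  = λ x R R∈ →
        R , (R , (λ z → R , R∈ , id) , id , id) , λ u r → u , r , refl
    }

  -- The inverse that the natural isomorphism asks for: the witnesses of `forth` and `back` in
  -- `id-to-HN` trade places.
  id-from-HN : IsMultiHom (H-frame κ (N-frame M) complete) M id
  id-from-HN = record
    { forth = λ x R R∈ →
        R , (R , (λ z → R , R∈ , id) , id , id) , λ y r → r
    ; back  = λ x R (v , v∈ , _ , v⊆R) →
        let (Q , Q∈ , Q⊆v) = v∈ x
        in Q , Q∈ , λ u q → u , v⊆R (Q⊆v q) , refl
    }

module _ (em : ExcludedMiddle ℓ) (κ : Cardinal k)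
         (Z : NbhdFrame ℓ) (complete : IsComplete κ Z) where
  open NbhdFrame Z
  open IsComplete complete

  extend-nbhd : ∀ x {X : Pred C ℓ} → X ∈ ν x → ∃[ v ] (v ∈ V Z × v x ⊆ X)
  extend-nbhd x {X} X∈ = v , v∈ , λ s → s refl
    where
    v : C → Pred C ℓ
    -- The implication encodes the case split: `X` at `x`, vacuously all of `C` elsewhere. Excluded
    -- middle enters only in the proof of `v∈`.
    v z u = z ≡ x → u ∈ X

    v∈ : v ∈ V Z
    v∈ z with em {z ≡ x}
    ... | yes refl = upward x (λ s _ → s) X∈
    ... | no z≢x   = upward z (λ _ z≡x → ⊥-elim (z≢x z≡x)) (whole z)

  -- Preimage under `id` is definitionally `X`, so two neighborhood systems are compared at `x`:
  -- extending `X` to some `v` gives one inclusion, upward closure from `v x` the other.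
  id-to-NH : IsNbhdHom Z (N-frame (H-frame κ Z complete)) id
  id-to-NH x X = mk⇔ to from
    where
    to : X ∈ ν x → X ∈ NbhdFrame.ν (N-frame (H-frame κ Z complete)) x
    to X∈ = let (v , v∈ , v⊆X) = extend-nbhd x X∈
            in R⟨ v ⟩ , (v , v∈ , id , id) , v⊆X

    from : X ∈ NbhdFrame.ν (N-frame (H-frame κ Z complete)) x → X ∈ ν x
    from (R , (v , v∈ , _ , v⊆R) , R⊆X) = upward x (λ s → R⊆X (v⊆R s)) (v∈ x)

  id-from-NH : IsNbhdHom (N-frame (H-frame κ Z complete)) Z id
  id-from-NH x X = ⇔-sym (id-to-NH x X)

theorem6p4 :
  (em : Classical) {k : Level} (ℓ : Level) (κ : Cardinal k) →
  let module MKF = Category (MKF ℓ κ)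
      module NFR = Category (NFR ℓ κ)
      module N = Functor (N {ℓ = ℓ} em κ)
      module H = Functor (H {ℓ = ℓ} em κ)
  in
    (∀ (M : MKF.Obj) → IsMultiIso (proj₁ M) (proj₁ (H.F₀ (N.F₀ M))) id)
    × (∀ (Z : NFR.Obj) → IsNbhdIso (proj₁ Z) (proj₁ (N.F₀ (H.F₀ Z))) id)
    × (Σ[ E ∈ IsEquivalenceOfCategories (N {ℓ = ℓ} em κ) (H em κ) ]
        (∀ (M : MKF.Obj) x → MKFHom.map (NaturalIso.to (IsEquivalenceOfCategories.unit E) M) x ≡ x)
        × (∀ (Z : NFR.Obj) x → NFRHom.map (NaturalIso.to (IsEquivalenceOfCategories.counit E) Z) x ≡ x))
theorem6p4 em ℓ κ =
    (λ (M , d) → id-to-HN κ M (N-complete em κ M d) , bijective _≡_)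
  , (λ (Z , c) → id-to-NH (em ℓ) κ Z c , bijective _≡_)
  , record
      { unit = record
        { to      = λ (M , d) → record { map = id ; isHom = id-to-HN κ M (N-complete em κ M d) }
        ; from    = λ (M , d) → record { map = id ; isHom = id-from-HN κ M (N-complete em κ M d) }
        -- Morphisms are compared pointwise, and both functors keep the underlying map, so every law
        -- holds by computation.
        ; to-from = λ _ _ → refl
        ; from-to = λ _ _ → refl
        ; natural = λ _ _ → refl
        }
      ; counit = record
        { to      = λ (Z , c) → record { map = id ; isHom = id-to-NH (em ℓ) κ Z c }
        ; from    = λ (Z , c) → record { map = id ; isHom = id-from-NH (em ℓ) κ Z c }
        ; to-from = λ _ _ → refl
        ; from-to = λ _ _ → refl
        ; natural = λ _ _ → refl
        }
      }
  , (λ _ _ → refl)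
  , (λ _ _ → refl)
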